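{- Let $n\ge 4$ be an integer, let $\Sigma$ be a finite alphabet of size at least $2$, and let $h:\Sigma^*\to\Sigma^*$ be a morphism. Let $G_h$ be the subgroup of $\mathbb{Z}^{\Sigma}$ generated by $\psi(h(\Sigma))=\{\psi(h(\sigma)):\sigma\in\Sigma\}$. For $e\in\mathbb{Z}^\Sigma$ let $\overline{e}\in\mathbb{Z}^{\Sigma}/G_h$ denote its class modulo $G_h$. Let $\mathcal{P}=\psi(\operatorname{Pref}(h))$ and $\overline{\mathcal{P}}=\{\overline{v}:v\in\mathcal{P}\}\subseteq \mathbb{Z}^\Sigma/G_h$. Suppose that the following conditions hold: (O1) The frequency matrix of $h$ is non-singular. (O2) $\operatorname{a-rk}(\overline{\mathcal{P}})\le n$. (O3) For every $v\in\mathcal{P}\setminus(\psi(h(\Sigma))\cup\{0\})$, the equivalence class $[v]_{\mathcal{P}}=\{w\in\mathcal{P}: w-v\in G_h\}$ contains at most $2$ elements, and the Parikh vector of a non-empty proper prefix of $h$ (that is, of a non-empty proper prefix of $h(\sigma)$ for some $\sigma\in\Sigma$) is not in the equivalence class of the zero vector $0\in\mathbb{Z}^\Sigma$ modulo $G_h$. Moreover, if $[v]_{\mathcal{P}}=\{v,w\}$ with $v\ne w$, then $v-w=\psi(h(p))-\psi(h(q))$ for unique $p,q\in\Sigma$ where $v\in\psi(\operatorname{Pref}(h(p)))$ and $w\in\psi(\operatorname{Pref}(h(q)))$. Then $h$ is an abelian $n$-power free morphism.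
   Context: $\Sigma^*$ is the free monoid of finite words over $\Sigma=\{\sigma_1,\dots,\sigma_m\}$, with empty word $\epsilon$; $\mathbb{Z}^\Sigma$ is the free $\mathbb{Z}$-module on $\Sigma$. A morphism $h:\Sigma^*\to\Sigma^*$ is a monoid homomorphism. The Parikh vector $\psi(u)\in\mathbb{N}^m\subset\mathbb{Z}^\Sigma$ of a word $u$ has $i$-th coordinate the number of occurrences of $\sigma_i$ in $u$. For a set of words $S$, $\psi(S)=\{\psi(u):u\in S\}$. The frequency matrix of $h$ is the $m\times m$ matrix whose $i$-th row is $\psi(h(\sigma_i))$. $\operatorname{Pref}(u)$ is the set of all prefixes of $u$ (including $\epsilon$ and $u$), and $\operatorname{Pref}(h)=\bigcup_{\sigma\in\Sigma}\operatorname{Pref}(h(\sigma))$. For an abelian group $G$ an arithmetic progression of length $k$ in $G$ is a sequence $a,a+d,\dots,a+(k-1)d$ with $a,d\in G$; it is trivial if $d=0$. For $A\subseteq G$, $\operatorname{a-rk}(A)$ is the length of a longest non-trivial arithmetic progression all of whose terms lie in $A$ (terms may repeat), and $\operatorname{a-rk}(A)=\infty$ if these lengths are unbounded. A word $u$ (finite or infinite) is abelian $k$-power free if whenever $u=xv_1\cdots v_ky$ with $\psi(v_1)=\cdots=\psi(v_k)$, one has $v_1=\cdots=v_k=\epsilon$. A morphism $h$ is abelian $n$-power free if $h(u)$ is abelian $n$-power free for every abelian $n$-power free word $u$. -}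

module Defs where

open import Algebra.Bundles using (AbelianGroup)
open import Algebra.Construct.Pointwise using () renaming (abelianGroup to pointwise)
open import Algebra.Morphism.Structures using (IsMonoidHomomorphism)
import Algebra.Definitions.RawMonoid as RawMonoidDefs
import Algebra.Properties.AbelianGroup as AbelianGroupProperties
import Algebra.Properties.CommutativeSemigroup as CommutativeSemigroupProperties
open import Data.Fin.Base using (Fin)
open import Data.Fin.Properties using (_≟_)
open import Data.Integer.Base as ℤ using (ℤ)
import Data.Integer.Properties as ℤ
open import Data.List.Base
  using (List; []; [_]; _++_; length; filter; concat; tabulate; applyUpTo; ++-[]-rawMonoid)
open import Data.List.Relation.Binary.Prefix.Heterogeneous using (Prefix)
open import Data.Nat.Base as ℕ using (ℕ)
open import Data.Product.Base using (_×_; _,_; ∃; ∃-syntax)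
open import Data.Rational.Base as ℚ using (ℚ; 0ℚ; 1ℚ)
open import Data.Bool.Base using (if_then_else_)
open import Data.Sum.Base using (_⊎_)
open import Function.Bundles using (_⇔_)
open import Level using (Level; _⊔_; 0ℓ)
open import Relation.Binary.PropositionalEquality.Core using (_≡_; _≢_)
open import Relation.Nullary.Decidable.Core using (does)
open import Relation.Nullary.Negation.Core using (¬_)
open import Relation.Unary using (Pred; _∈_; _∉_)

private
  variable
    m : ℕ

module _ {c ℓ : Level} (G : AbelianGroup c ℓ) where

  open AbelianGroup G
  private
    module P = AbelianGroupProperties G
    module CS = CommutativeSemigroupProperties commutativeSemigroup

  data Generated {p : Level} (S : Pred Carrier p) : Pred Carrier (c ⊔ ℓ ⊔ p) where
    gen  : ∀ {x} → x ∈ S → x ∈ Generated S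
    ε∈   : ε ∈ Generated S
    ∙∈   : ∀ {x y} → x ∈ Generated S → y ∈ Generated S → (x ∙ y) ∈ Generated S
    ⁻¹∈  : ∀ {x} → x ∈ Generated S → (x ⁻¹) ∈ Generated S
    resp : ∀ {x y} → x ≈ y → x ∈ Generated S → y ∈ Generated S

  -- The quotient keeps the carrier of G; the class of x is x itself, and
  -- two elements are identified when their difference is in the subgroup.
  Quotient : {p : Level} → Pred Carrier p → AbelianGroup c (c ⊔ ℓ ⊔ p)
  Quotient S = record
    { Carrier = Carrier
    ; _≈_     = λ x y → (x - y) ∈ Generated S
    ; _∙_     = _∙_
    ; ε       = ε
    ; _⁻¹     = _⁻¹
    ; isAbelianGroup = record
      { isGroup = record
        { isMonoid = record
          { isSemigroup = record
            { isMagma = record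
              { isEquivalence = record
                { refl  = ≈⇒∼ refl
                ; sym   = λ {x} {y} p →
                    resp (P.⁻¹-anti-homo‿- x y) (⁻¹∈ p)
                ; trans = λ {x} {y} {z} p q → resp (telescope x y z) (∙∈ p q)
                }
              ; ∙-cong = λ {x} {y} {u} {v} p q →
                  resp (interchange x y u v) (∙∈ p q)
              }
            ; assoc = λ x y z → ≈⇒∼ (assoc x y z)
            }
          ; identity = (λ x → ≈⇒∼ (identityˡ x)) , (λ x → ≈⇒∼ (identityʳ x))
          }
        ; inverse = (λ x → ≈⇒∼ (inverseˡ x)) , (λ x → ≈⇒∼ (inverseʳ x))
        ; ⁻¹-cong = λ {x} {y} p → resp (sym (P.⁻¹-∙-comm x (y ⁻¹))) (⁻¹∈ p)
        }
      ; comm = λ x y → ≈⇒∼ (comm x y)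
      }
    }
    where
    ≈⇒∼ : ∀ {x y} → x ≈ y → (x - y) ∈ Generated S
    ≈⇒∼ x≈y = resp (sym (P.x≈y⇒x∙y⁻¹≈ε x≈y)) ε∈

    telescope : ∀ x y z → (x - y) ∙ (y - z) ≈ x - z
    telescope x y z =
      trans (assoc x (y ⁻¹) (y - z)) (∙-congˡ (P.\\-leftDividesʳ y (z ⁻¹)))

    interchange : ∀ x y u v → (x - y) ∙ (u - v) ≈ (x ∙ u) - (y ∙ v)
    interchange x y u v =
      trans (CS.interchange x (y ⁻¹) u (v ⁻¹)) (∙-congˡ (P.⁻¹-∙-comm y v))

  open RawMonoidDefs rawMonoid using () renaming (_×_ to _·_)

  HasNontrivialAP : {p : Level} → Pred Carrier p → ℕ → Set (c ⊔ ℓ ⊔ p)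
  HasNontrivialAP A k =
    ∃[ a ] ∃[ d ] (¬ (d ≈ ε) × (∀ i → i ℕ.< k → (a ∙ (i · d)) ∈ A))

  -- a-rk(A) is the supremum in ℕ ∪ {∞} of the lengths of the non-trivial
  -- progressions in A, so a-rk(A) ≤ n says that n bounds these lengths.
  ARank≤ : {p : Level} → Pred Carrier p → ℕ → Set (c ⊔ ℓ ⊔ p)
  ARank≤ A n = ∀ k → HasNontrivialAP A k → k ℕ.≤ n

Matrix : Set → ℕ → Set
Matrix A m = Fin m → Fin m → A

open RawMonoidDefs ℚ.+-0-rawMonoid using () renaming (sum to sumℚ)

_*ᴹ_ : Matrix ℚ m → Matrix ℚ m → Matrix ℚ m
(A *ᴹ B) i j = sumℚ (λ k → A i k ℚ.* B k j)

1ᴹ : Matrix ℚ m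
1ᴹ i j = if does (i ≟ j) then 1ℚ else 0ℚ

-- Invertibility over ℚ; over ℤ it would say that the determinant is ±1.
NonSingular : Matrix ℤ m → Set
NonSingular {m} M = ∃[ N ] ((∀ i j → (Mℚ *ᴹ N) i j ≡ 1ᴹ i j) × (∀ i j → (N *ᴹ Mℚ) i j ≡ 1ᴹ i j))
  where
  Mℚ : Matrix ℚ m
  Mℚ i j = M i j ℚ./ 1

Word : ℕ → Set
Word m = List (Fin m)

ℤ^ : ℕ → AbelianGroup 0ℓ 0ℓ
ℤ^ m = pointwise (Fin m) ℤ.+-0-abelianGroup

Vector : ℕ → Set
Vector m = AbelianGroup.Carrier (ℤ^ m)

module _ {m : ℕ} where

  open AbelianGroup (ℤ^ m) public using ()
    renaming (_≈_ to _≈ᵛ_; ε to 0ᵛ; _-_ to _-ᵛ_)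

  ψ : Word m → Vector m
  ψ u i = ℤ.+ length (filter (i ≟_) u)

  ψ[_] : Pred (Word m) 0ℓ → Pred (Vector m) 0ℓ
  ψ[ S ] v = ∃[ u ] (u ∈ S × v ≈ᵛ ψ u)

  Pref : Word m → Pred (Word m) 0ℓ
  Pref u p = Prefix _≡_ p u

data Word∞ (m : ℕ) : Set where
  finite   : Word m → Word∞ m
  infinite : (ℕ → Fin m) → Word∞ m

_≼_ : Word m → Word∞ m → Set
p ≼ finite u   = p ∈ Pref u
p ≼ infinite s = p ≡ applyUpTo s (length p)

-- A factorisation u = x v₁ ⋯ v_k y is the same thing as a prefix
-- x v₁ ⋯ v_k of u, the remaining y being finite or infinite like u.
AbelianPowerFree : ℕ → Word∞ m → Set
AbelianPowerFree {m} k u =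
  ∀ (x : Word m) (v : Fin k → Word m) →
  (x ++ concat (tabulate v)) ≼ u →
  (∀ i j → ψ (v i) ≈ᵛ ψ (v j)) →
  ∀ i → v i ≡ []

IsMorphism : (Word m → Word m) → Set
IsMorphism {m} = IsMonoidHomomorphism (++-[]-rawMonoid (Fin m)) (++-[]-rawMonoid (Fin m))

-- The image of an infinite word s is the word whose prefixes are those of
-- the images of the finite prefixes of s; it is finite if h erases all but
-- finitely many letters of s.
IsImage : (Word m → Word m) → Word∞ m → Word∞ m → Set
IsImage h (finite u)   z = z ≡ finite (h u)
IsImage h (infinite s) z = ∀ p → p ≼ z ⇔ (∃[ l ] p ∈ Pref (h (applyUpTo s l)))

AbelianPowerFreeMorphism : ℕ → (Word m → Word m) → Set
AbelianPowerFreeMorphism n h =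
  ∀ u z → IsImage h u z → AbelianPowerFree n u → AbelianPowerFree n z

module _ {m : ℕ} (h : Word m → Word m) where

  frequencyMatrix : Matrix ℤ m
  frequencyMatrix i = ψ (h [ i ])

  letterImages : Pred (Word m) 0ℓ
  letterImages w = ∃[ σ ] w ≡ h [ σ ]

  Prefᴹ : Pred (Word m) 0ℓ
  Prefᴹ p = ∃[ σ ] p ∈ Pref (h [ σ ])

  𝒫 : Pred (Vector m) 0ℓ
  𝒫 = ψ[ Prefᴹ ]

  ℤ^/G : AbelianGroup 0ℓ 0ℓ
  ℤ^/G = Quotient (ℤ^ m) ψ[ letterImages ]

  open AbelianGroup ℤ^/G using () renaming (_≈_ to _∼_)

  𝒫̄ : Pred (AbelianGroup.Carrier ℤ^/G) 0ℓ
  𝒫̄ e = ∃[ v ] (v ∈ 𝒫 × e ∼ v)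

  [_]𝒫 : Vector m → Pred (Vector m) 0ℓ
  [ v ]𝒫 w = w ∈ 𝒫 × w ∼ v

  AtMostTwo : Pred (Vector m) 0ℓ → Set
  AtMostTwo C = ∀ x y z → x ∈ C → y ∈ C → z ∈ C → x ≈ᵛ y ⊎ x ≈ᵛ z ⊎ y ≈ᵛ z

  O1 : Set
  O1 = NonSingular frequencyMatrix

  O2 : ℕ → Set
  O2 n = ARank≤ ℤ^/G 𝒫̄ n

  -- Uniqueness of p (and likewise q) means that p is the only letter whose
  -- image has a prefix with Parikh vector v.  Uniqueness of the pair (p , q)
  -- subject to the displayed equation would be void, since by O1 that equation
  -- alone determines p and q when v and w differ.
  UniqueLetters : Vector m → Vector m → Set
  UniqueLetters v w = ∃[ p ] ∃[ q ]
    ( (v -ᵛ w) ≈ᵛ (ψ (h [ p ]) -ᵛ ψ (h [ q ]))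
    × (∀ σ → v ∈ ψ[ Pref (h [ σ ]) ] ⇔ σ ≡ p)
    × (∀ σ → w ∈ ψ[ Pref (h [ σ ]) ] ⇔ σ ≡ q) )

  record O3 : Set where
    field
      smallClasses : ∀ v → v ∈ 𝒫 → v ∉ ψ[ letterImages ] → ¬ (v ≈ᵛ 0ᵛ) →
        AtMostTwo [ v ]𝒫
      properPrefixes : ∀ σ p → p ∈ Pref (h [ σ ]) → p ≢ [] → p ≢ h [ σ ] →
        ¬ (ψ p ∼ 0ᵛ)
      pairs : ∀ v w → v ∈ 𝒫 → v ∉ ψ[ letterImages ] → ¬ (v ≈ᵛ 0ᵛ) →
        ¬ (v ≈ᵛ w) → (∀ x → x ∈ [ v ]𝒫 ⇔ (x ≈ᵛ v ⊎ x ≈ᵛ w)) →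
        UniqueLetters v w

{-# OPTIONS --safe #-}
-- Let x v₁ ⋯ vₙ be a prefix of h u with all ψ(vᵢ) equal.  Each of its n + 1 cut
-- points has the form h(bᵢ) rᵢ with bᵢ a prefix of u and rᵢ empty or a non-empty
-- proper prefix of the image of the next letter.  Modulo G_h the ψ(rᵢ) form a
-- progression of length n + 1, so (O2) makes them all congruent.  By (O3) they
-- take at most two values, and the bᵢ (one value) or the bᵢ extended by their
-- next letter (two values) are prefixes cᵢ of u such that ψ(h(cᵢ)) differs
-- from the Parikh vector of the i-th cut point by a constant.  By (O1) the cᵢ
-- then cut an abelian n-power out of u.
module Submission where

open import Defs
open import Data.Nat.Base using (ℕ; _≤_)

open import Algebra.Bundles using (AbelianGroup)
open import Algebra.Morphism.Structures using (IsMonoidHomomorphism)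
import Algebra.Definitions.RawMonoid as RawMonoidDefs
import Algebra.Properties.CommutativeMonoid.Sum as CommutativeMonoidSum
import Algebra.Properties.Group as GroupProperties
open import Data.Fin.Base as Fin using (Fin; zero; suc; toℕ; fromℕ; fromℕ<; inject₁)
import Data.Fin.Properties as Fin
open import Data.Integer.Base as ℤ using (ℤ; +_)
import Data.Integer.Properties as ℤ
open import Data.Integer.Tactic.RingSolver using (solve-∀)
open import Data.List.Base using ([]; _∷_; [_]; _++_; length; filter; concat; tabulate; applyUpTo)
open import Data.List.Properties
  using (++-assoc; ++-identityʳ; ∷-injectiveʳ; filter-accept; filter-++; length-++; ≡-dec)
open import Data.List.Relation.Binary.Prefix.Heterogeneous using (Prefix; []; _∷_)
import Data.List.Relation.Binary.Prefix.Heterogeneous.Properties as Prefix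
open import Data.Nat.Base as ℕ using (zero; suc; _<_; s≤s; z≤n)
import Data.Nat.Properties as ℕ
open import Data.Product.Base using (_×_; _,_; ∃-syntax; proj₁; proj₂)
open import Data.Rational.Base as ℚ using (ℚ)
import Data.Rational.Properties as ℚ
open import Data.Rational.Unnormalised.Base as ℚᵘ using (mkℚᵘ; *≡*)
import Data.Rational.Unnormalised.Properties as ℚᵘ
open import Data.Sum.Base using (_⊎_; inj₁; inj₂)
open import Function.Base using (_∘_)
open import Function.Bundles using (Equivalence; mk⇔)
open import Relation.Binary.PropositionalEquality
  using (_≡_; _≢_; refl; sym; trans; cong; cong₂; subst; module ≡-Reasoning)
import Relation.Binary.Reasoning.Setoid as SetoidReasoning
open import Relation.Nullary using (¬_; Dec; yes; no; contradiction)
open import Relation.Nullary.Decidable using (decidable-stable)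
open import Relation.Unary using (_∈_; _∉_)

private
  variable
    m n : ℕ

module ℤGroup = GroupProperties (AbelianGroup.group ℤ.+-0-abelianGroup)

-- Prefixes

Prefix-trans : {p q u : Word m} → p ∈ Pref q → q ∈ Pref u → p ∈ Pref u
Prefix-trans = Prefix.trans trans

Prefix-++ : (p t : Word m) → p ∈ Pref (p ++ t)
Prefix-++ []      t = []
Prefix-++ (_ ∷ p) t = refl ∷ Prefix-++ p t

Prefix⇒++ : {p u : Word m} → p ∈ Pref u → ∃[ t ] p ++ t ≡ u
Prefix⇒++ []          = _ , refl
Prefix⇒++ (refl ∷ ps) = let t , eq = Prefix⇒++ ps in t , cong (_ ∷_) eq

Prefix-by-length : {p q u : Word m} → p ∈ Pref u → q ∈ Pref u → length p ≤ length q → p ∈ Pref q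
Prefix-by-length []          _           _         = []
Prefix-by-length (refl ∷ ps) (refl ∷ qs) (s≤s p≤q) = refl ∷ Prefix-by-length ps qs p≤q

Prefix-≢⇒< : {p u : Word m} → p ∈ Pref u → p ≢ u → length p < length u
Prefix-≢⇒< {u = []}    []          p≢u = contradiction refl p≢u
Prefix-≢⇒< {u = _ ∷ _} []          p≢u = s≤s z≤n
Prefix-≢⇒<             (refl ∷ ps) p≢u = s≤s (Prefix-≢⇒< ps (p≢u ∘ cong (_ ∷_)))

-- The case `q ≡ a` belongs to the second alternative, with empty `r`, so that a cut at the end of a
-- letter's image leaves no remainder.
Prefix-++⁻ : ∀ {q} (a b : Word m) → q ∈ Pref (a ++ b) →
             (q ∈ Pref a × q ≢ a) ⊎ (∃[ r ] q ≡ a ++ r × r ∈ Pref b)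
Prefix-++⁻ []      b qs = inj₂ (_ , refl , qs)
Prefix-++⁻ (_ ∷ _) b [] = inj₁ ([] , λ ())
Prefix-++⁻ (_ ∷ a) b (refl ∷ qs) with Prefix-++⁻ a b qs
... | inj₁ (q∈ , q≢a)     = inj₁ (refl ∷ q∈ , q≢a ∘ ∷-injectiveʳ)
... | inj₂ (r , eq , r∈)  = inj₂ (r , cong (_ ∷_) eq , r∈)

Prefix-applyUpTo : ∀ (s : ℕ → Fin m) l {p} → p ∈ Pref (applyUpTo s l) → p ≼ infinite s
Prefix-applyUpTo s zero    []          = refl
Prefix-applyUpTo s (suc l) []          = refl
Prefix-applyUpTo s (suc l) (refl ∷ ps) = cong (s 0 ∷_) (Prefix-applyUpTo (s ∘ suc) l ps)

partials : Word m → (Fin n → Word m) → Fin (suc n) → Word m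
partials             x v zero    = x
partials {n = suc _} x v (suc i) = partials (x ++ v zero) (v ∘ suc) i

partials-suc : ∀ x (v : Fin n → Word m) i → partials x v (suc i) ≡ partials x v (inject₁ i) ++ v i
partials-suc x v zero    = refl
partials-suc x v (suc i) = partials-suc (x ++ v zero) (v ∘ suc) i

partials-prefix : ∀ x (v : Fin n → Word m) i → partials x v i ∈ Pref (x ++ concat (tabulate v))
partials-prefix x v zero = Prefix-++ x _
partials-prefix {n = suc _} x v (suc i) =
  subst (λ u → partials (x ++ v zero) (v ∘ suc) i ∈ Pref u) (++-assoc x (v zero) _)
    (partials-prefix (x ++ v zero) (v ∘ suc) i)

-- Reassembles the factors of an increasing chain of prefixes, to recognise the power pulled back to
-- `u` as a prefix of `u`.
++-telescope : (g : Fin (suc n) → Word m) (w : Fin n → Word m) →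
               (∀ i → g (inject₁ i) ++ w i ≡ g (suc i)) →
               g zero ++ concat (tabulate w) ≡ g (fromℕ n)
++-telescope {n = zero}  g w eq = ++-identityʳ (g zero)
++-telescope {n = suc _} g w eq = trans (sym (++-assoc (g zero) (w zero) _))
  (trans (cong (_++ concat (tabulate (w ∘ suc))) (eq zero)) (++-telescope (g ∘ suc) (w ∘ suc) (eq ∘ suc)))

-- Parikh vectors

module _ {m : ℕ} where
  open AbelianGroup (ℤ^ m) public using () renaming (_∙_ to _+ᵛ_; _⁻¹ to -ᵛ_)

_≟ᵛ_ : (x y : Vector m) → Dec (x ≈ᵛ y)
x ≟ᵛ y = Fin.all? λ i → x i ℤ.≟ y i

ψ-++ : (u v : Word m) → ψ (u ++ v) ≈ᵛ (ψ u +ᵛ ψ v)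
ψ-++ u v i = cong +_ (trans (cong length (filter-++ (i Fin.≟_) u v)) (length-++ (filter (i Fin.≟_) u)))

ψ≈0⇒[] : (u : Word m) → ψ u ≈ᵛ 0ᵛ → u ≡ []
ψ≈0⇒[] []      _   = refl
ψ≈0⇒[] (σ ∷ u) eq  with () ← trans (sym (cong (+_ ∘ length) (filter-accept (σ Fin.≟_) {x = σ} {xs = u} refl))) (eq σ)

-- Integers inside the rationals

/1-injective : ∀ {i j} → i ℚ./ 1 ≡ j ℚ./ 1 → i ≡ j
/1-injective {i} {j} eq with *≡* e ← ℚ./-injective-≃ (mkℚᵘ i 0) (mkℚᵘ j 0) eq = ℤ.*-cancelʳ-≡ i j (+ 1) e

-- Rationals are kept in lowest terms, so the equation is checked on unnormalised fractions of
-- denominator 1, where it is a ring identity.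
/1-homo-+ : ∀ i j → (i ℤ.+ j) ℚ./ 1 ≡ i ℚ./ 1 ℚ.+ j ℚ./ 1
/1-homo-+ i j = ℚ.toℚᵘ-injective (begin
  ℚ.toℚᵘ ((i ℤ.+ j) ℚ./ 1)                     ≈⟨ ℚ.toℚᵘ-fromℚᵘ (mkℚᵘ (i ℤ.+ j) 0) ⟩
  mkℚᵘ (i ℤ.+ j) 0                             ≈⟨ *≡* (lemma i j) ⟩
  mkℚᵘ i 0 ℚᵘ.+ mkℚᵘ j 0
    ≈⟨ ℚᵘ.+-cong (ℚ.toℚᵘ-fromℚᵘ (mkℚᵘ i 0)) (ℚ.toℚᵘ-fromℚᵘ (mkℚᵘ j 0)) ⟨
  ℚ.toℚᵘ (i ℚ./ 1) ℚᵘ.+ ℚ.toℚᵘ (j ℚ./ 1)       ≈⟨ ℚ.toℚᵘ-homo-+ (i ℚ./ 1) (j ℚ./ 1) ⟨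
  ℚ.toℚᵘ (i ℚ./ 1 ℚ.+ j ℚ./ 1)                 ∎)
  where
  open ℚᵘ.≃-Reasoning
  lemma : ∀ i j → (i ℤ.+ j) ℤ.* + 1 ≡ (i ℤ.* + 1 ℤ.+ j ℤ.* + 1) ℤ.* + 1
  lemma = solve-∀

-- Injectivity of h on Parikh vectors

module _ {m : ℕ} (h : Word m → Word m) (isMorphism : IsMorphism h) where

  open IsMonoidHomomorphism isMorphism using (homo; ε-homo)

  module ℚΣ = CommutativeMonoidSum ℚ.+-0-commutativeMonoid

  -- If M is the frequency matrix, ψ(h(u)) is the row vector ψ(u)M. Multiplying by its right inverse
  -- `N` over ℚ, which is what `solve` does, recovers ψ(u).
  ψ∘h-injective : O1 h → ∀ u v → ψ (h u) ≈ᵛ ψ (h v) → ψ u ≈ᵛ ψ v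
  ψ∘h-injective (N , MN≡1 , _) u v eq j = /1-injective (begin
    ψ u j ℚ./ 1       ≡⟨ solve-ψ∘h u j ⟨
    solve (ψ (h u)) j ≡⟨ solve-cong eq j ⟩
    solve (ψ (h v)) j ≡⟨ solve-ψ∘h v j ⟩
    ψ v j ℚ./ 1       ∎)
    where
    open ≡-Reasoning
    solve : Vector m → Fin m → ℚ
    solve y j = ℚΣ.sum (λ k → (y k ℚ./ 1) ℚ.* N k j)

    solve-cong : ∀ {y z} → y ≈ᵛ z → ∀ j → solve y j ≡ solve z j
    solve-cong y≈z j = ℚΣ.sum-cong-≗ (λ k → cong (λ e → (e ℚ./ 1) ℚ.* N k j) (y≈z k))

    solve-+ : ∀ y z j → solve (y +ᵛ z) j ≡ solve y j ℚ.+ solve z j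
    solve-+ y z j = trans
      (ℚΣ.sum-cong-≗ (λ k → trans (cong (ℚ._* N k j) (/1-homo-+ (y k) (z k))) (ℚ.*-distribʳ-+ (N k j) (y k ℚ./ 1) (z k ℚ./ 1))))
      (ℚΣ.∑-distrib-+ (λ k → (y k ℚ./ 1) ℚ.* N k j) (λ k → (z k ℚ./ 1) ℚ.* N k j))

    solve-0 : ∀ j → solve 0ᵛ j ≡ ℚ.0ℚ
    solve-0 j = trans (ℚΣ.sum-cong-≗ (λ k → ℚ.*-zeroˡ (N k j))) (ℚΣ.sum-replicate-zero m)

    1ᴹ-ψ : ∀ σ j → 1ᴹ σ j ≡ ψ [ σ ] j ℚ./ 1
    -- `1ᴹ` tests `σ ≟ j` but `ψ` tests `j ≟ σ`, so both decisions are made and the mixed cases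
    -- refuted.
    1ᴹ-ψ σ j with σ Fin.≟ j | j Fin.≟ σ
    ... | yes _    | yes _    = refl
    ... | no _     | no _     = refl
    ... | yes refl | no j≢j   = contradiction refl j≢j
    ... | no j≢j   | yes refl = contradiction refl j≢j

    solve-ψ∘h : ∀ u j → solve (ψ (h u)) j ≡ ψ u j ℚ./ 1
    solve-ψ∘h [] j = trans (cong (λ w → solve (ψ w) j) ε-homo) (solve-0 j)
    solve-ψ∘h (σ ∷ u) j = begin
      solve (ψ (h (σ ∷ u))) j                       ≡⟨ cong (λ w → solve (ψ w) j) (homo [ σ ] u) ⟩
      solve (ψ (h [ σ ] ++ h u)) j                  ≡⟨ solve-cong (ψ-++ (h [ σ ]) (h u)) j ⟩
      solve (ψ (h [ σ ]) +ᵛ ψ (h u)) j              ≡⟨ solve-+ (ψ (h [ σ ])) (ψ (h u)) j ⟩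
      solve (ψ (h [ σ ])) j ℚ.+ solve (ψ (h u)) j   ≡⟨ cong₂ ℚ._+_ (trans (MN≡1 σ j) (1ᴹ-ψ σ j)) (solve-ψ∘h u j) ⟩
      ψ [ σ ] j ℚ./ 1 ℚ.+ ψ u j ℚ./ 1               ≡⟨ /1-homo-+ (ψ [ σ ] j) (ψ u j) ⟨
      (ψ [ σ ] j ℤ.+ ψ u j) ℚ./ 1                   ≡⟨ cong (ℚ._/ 1) (ψ-++ [ σ ] u j) ⟨
      ψ (σ ∷ u) j ℚ./ 1                             ∎

  -- An erased letter would have the image of the empty word, and injectivity would give it Parikh
  -- vector zero.
  nonerasing : O1 h → ∀ σ → h [ σ ] ≢ []
  nonerasing o1 σ hσ≡[] = contradiction (ψ≈0⇒[] [ σ ] (ψ∘h-injective o1 [ σ ] [] ψhσ≈ψh[])) λ ()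
    where
    ψhσ≈ψh[] : ψ (h [ σ ]) ≈ᵛ ψ (h [])
    ψhσ≈ψh[] i = cong (λ w → ψ w i) (trans hσ≡[] (sym ε-homo))

  h-Prefix : ∀ {p u} → p ∈ Pref u → h p ∈ Pref (h u)
  h-Prefix {p} p⊑u with t , refl ← Prefix⇒++ p⊑u =
    subst (λ w → h p ∈ Pref w) (sym (homo p t)) (Prefix-++ (h p) (h t))

  -- Cut points

  -- The two inequalities make `rest` a non-empty proper prefix, as (O3) requires. `within` keeps
  -- `base` extended by `letter` inside `u`, where it can serve as a pulled-back cut point.
  record Inside (u base rest : Word m) : Set where
    constructor mkInside
    field
      letter  : Fin m
      within  : (base ++ [ letter ]) ∈ Pref u
      rest∈   : rest ∈ Pref (h [ letter ])
      rest≢[] : rest ≢ []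
      rest≢h  : rest ≢ h [ letter ]

  record Cut (u q : Word m) : Set where
    constructor mkCut
    field
      base rest : Word m
      base∈     : base ∈ Pref u
      split     : q ≡ h base ++ rest
      position  : rest ≡ [] ⊎ Inside u base rest

  open Inside
  open Cut

  -- Images of letters are stripped from the left until what remains of `q` is shorter than the next
  -- image, or `u` is exhausted.
  cut : ∀ u {q} → q ∈ Pref (h u) → Cut u q
  cut [] {q} q∈ with [] ← subst (λ w → q ∈ Pref w) ε-homo q∈ =
    mkCut [] [] [] (sym (trans (++-identityʳ _) ε-homo)) (inj₁ refl)
  cut (σ ∷ u) {q} q∈ with Prefix-++⁻ (h [ σ ]) (h u) (subst (λ w → q ∈ Pref w) (homo [ σ ] u) q∈)
  ... | inj₂ (r , refl , r∈) = prepend (cut u r∈)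
    where
    prepend : Cut u r → Cut (σ ∷ u) (h [ σ ] ++ r)
    prepend (mkCut b t b∈ eq pos) = mkCut (σ ∷ b) t (refl ∷ b∈)
      (trans (cong (h [ σ ] ++_) eq)
        (trans (sym (++-assoc (h [ σ ]) (h b) t)) (cong (_++ t) (sym (homo [ σ ] b)))))
      (extend pos)
      where
      extend : t ≡ [] ⊎ Inside u b t → t ≡ [] ⊎ Inside (σ ∷ u) (σ ∷ b) t
      extend (inj₁ t≡[])                       = inj₁ t≡[]
      extend (inj₂ (mkInside τ bτ∈ t∈ t≢[] t≢h)) = inj₂ (mkInside τ (refl ∷ bτ∈) t∈ t≢[] t≢h)
  ... | inj₁ (q∈hσ , q≢hσ) with ≡-dec Fin._≟_ q []
  ...   | yes q≡[] = mkCut [] q [] (cong (_++ q) (sym ε-homo)) (inj₁ q≡[])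
  ...   | no  q≢[] = mkCut [] q [] (cong (_++ q) (sym ε-homo))
                       (inj₂ (mkInside σ (refl ∷ []) q∈hσ q≢[] q≢hσ))

  -- Order of the bases and pull-back of powers

  module _ (o1 : O1 h) where

    length-h-∷ : ∀ σ t → 0 < length (h (σ ∷ t))
    length-h-∷ σ t = ℕ.≤-trans (Prefix-≢⇒< [] (nonerasing o1 σ ∘ sym))
      (Prefix.length-mono (h-Prefix {[ σ ]} (refl ∷ [])))

    -- `a` contains at least the letter after the base, and the image of that letter reaches past
    -- `q`: at a boundary because it is non-empty, inside because `rest` is a proper prefix of it.
    Cut-overshoot : ∀ {u q a} (c : Cut u q) → a ∈ Pref u → length (base c) < length a →
                    length q < length (h a)
    Cut-overshoot {u} {q} {a} (mkCut b t b∈ refl pos) a∈ b<a = bound pos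
      where
      open ℕ.≤-Reasoning
      bound : t ≡ [] ⊎ Inside u b t → length (h b ++ t) < length (h a)
      bound (inj₁ refl) with Prefix⇒++ (Prefix-by-length b∈ a∈ (ℕ.<⇒≤ b<a))
      ... | []     , refl = contradiction (subst (λ w → length b < length w) (++-identityʳ b) b<a) (ℕ.<-irrefl refl)
      ... | σ ∷ a′ , refl = begin-strict
        length (h b ++ [])                     ≡⟨ length-++ (h b) ⟩
        length (h b) ℕ.+ 0                     <⟨ ℕ.+-monoʳ-< (length (h b)) (length-h-∷ σ a′) ⟩
        length (h b) ℕ.+ length (h (σ ∷ a′))   ≡⟨ length-++ (h b) ⟨
        length (h b ++ h (σ ∷ a′))             ≡⟨ cong length (homo b (σ ∷ a′)) ⟨
        length (h (b ++ σ ∷ a′))               ∎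
      bound (inj₂ (mkInside σ bσ∈ t∈ _ t≢h)) = begin-strict
        length (h b ++ t)                      ≡⟨ length-++ (h b) ⟩
        length (h b) ℕ.+ length t              <⟨ ℕ.+-monoʳ-< (length (h b)) (Prefix-≢⇒< t∈ t≢h) ⟩
        length (h b) ℕ.+ length (h [ σ ])      ≡⟨ length-++ (h b) ⟨
        length (h b ++ h [ σ ])                ≡⟨ cong length (homo b [ σ ]) ⟨
        length (h (b ++ [ σ ]))
          ≤⟨ Prefix.length-mono (h-Prefix (Prefix-by-length bσ∈ a∈ bσ≤a)) ⟩
        length (h a)                           ∎
        where
        bσ≤a : length (b ++ [ σ ]) ≤ length a
        bσ≤a = subst (_≤ length a) (sym (trans (length-++ b) (ℕ.+-comm (length b) 1))) b<a

    -- Otherwise the image of `base c` would be longer than `q′` by `Cut-overshoot`, although it is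
    -- a prefix of `q`.
    base-mono : ∀ {u q q′} (c : Cut u q) (c′ : Cut u q′) → q ∈ Pref q′ → base c ∈ Pref (base c′)
    base-mono {q = q} {q′} c c′ q∈q′ = Prefix-by-length (base∈ c) (base∈ c′) (ℕ.≮⇒≥ λ c′<c →
      ℕ.<-irrefl refl (begin-strict
        length q′                       <⟨ Cut-overshoot c′ (base∈ c) c′<c ⟩
        length (h (base c))             ≤⟨ Prefix.length-mono (Prefix-++ (h (base c)) (rest c)) ⟩
        length (h (base c) ++ rest c)   ≡⟨ cong length (split c) ⟨
        length q                        ≤⟨ Prefix.length-mono q∈q′ ⟩
        length q′                       ∎))
      where open ℕ.≤-Reasoning

    -- Consecutive `g i` differ by words `w i` with ψ(h(`w i`)) = ψ(`v i`), since the constant `c`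
    -- cancels. Injectivity makes the `w i` an abelian power in `u`, so they are empty and ψ(`v i`)
    -- is zero.
    pull-back : ∀ {u} → AbelianPowerFree n (finite u) →
      ∀ x (v : Fin n → Word m) → (∀ i j → ψ (v i) ≈ᵛ ψ (v j)) →
      (g : Fin (suc n) → Word m) (c : Vector m) →
      (∀ i → g i ∈ Pref u) → (∀ i → g (inject₁ i) ∈ Pref (g (suc i))) →
      (∀ i → ψ (h (g i)) ≈ᵛ (ψ (partials x v i) +ᵛ c)) →
      ∀ i → v i ≡ []
    pull-back {n} {u} free x v v≈v g c g∈ g-mono shift i = ψ≈0⇒[] (v i) (λ k →
      trans (sym (ψhw i k)) (cong (λ t → ψ t k) (trans (cong h (w≡[] i)) ε-homo)))
      where
      open ≡-Reasoning
      w : Fin n → Word m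
      w i = proj₁ (Prefix⇒++ (g-mono i))

      gw : ∀ i → g (inject₁ i) ++ w i ≡ g (suc i)
      gw i = proj₂ (Prefix⇒++ (g-mono i))

      swap : ∀ a b c → a ℤ.+ b ℤ.+ c ≡ a ℤ.+ c ℤ.+ b
      swap = solve-∀

      ψhw : ∀ i → ψ (h (w i)) ≈ᵛ ψ (v i)
      ψhw i k = ℤGroup.∙-cancelˡ (ψ P k ℤ.+ c k) _ _ (begin
        ψ P k ℤ.+ c k ℤ.+ ψ (h (w i)) k                  ≡⟨ cong (ℤ._+ ψ (h (w i)) k) (shift (inject₁ i) k) ⟨
        ψ (h (g (inject₁ i))) k ℤ.+ ψ (h (w i)) k        ≡⟨ ψ-++ (h (g (inject₁ i))) (h (w i)) k ⟨
        ψ (h (g (inject₁ i)) ++ h (w i)) k               ≡⟨ cong (λ t → ψ t k) (homo (g (inject₁ i)) (w i)) ⟨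
        ψ (h (g (inject₁ i) ++ w i)) k                   ≡⟨ cong (λ t → ψ (h t) k) (gw i) ⟩
        ψ (h (g (suc i))) k                              ≡⟨ shift (suc i) k ⟩
        ψ (partials x v (suc i)) k ℤ.+ c k               ≡⟨ cong (λ t → ψ t k ℤ.+ c k) (partials-suc x v i) ⟩
        ψ (P ++ v i) k ℤ.+ c k                           ≡⟨ cong (ℤ._+ c k) (ψ-++ P (v i) k) ⟩
        ψ P k ℤ.+ ψ (v i) k ℤ.+ c k                      ≡⟨ swap (ψ P k) (ψ (v i) k) (c k) ⟩
        ψ P k ℤ.+ c k ℤ.+ ψ (v i) k                      ∎)
        where P = partials x v (inject₁ i)

      w≡[] : ∀ i → w i ≡ []
      w≡[] = free (g zero) w
        (subst (_∈ Pref u) (sym (++-telescope g w gw)) (g∈ (fromℕ n)))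
        (λ i j → ψ∘h-injective o1 (w i) (w j)
          (λ k → trans (ψhw i k) (trans (v≈v i j k) (sym (ψhw j k)))))

  -- Congruence modulo the subgroup generated by the images

  open AbelianGroup (ℤ^/G h) using ()
    renaming (_≈_ to _∼_; refl to ∼-refl; trans to ∼-trans; ∙-cong to ∼-+-cong)

  module ∼-Reasoning = SetoidReasoning (AbelianGroup.setoid (ℤ^/G h))

  open RawMonoidDefs (AbelianGroup.rawMonoid (ℤ^/G h)) using () renaming (_×_ to _·_)

  -- The quotient has the operations of ℤ^m, so its multiples `i · d` are those of ℤ^m and this
  -- progression is exact, before any passage to classes.
  ψ-partials : ∀ x (v : Fin n → Word m) {d} → (∀ j → ψ (v j) ≈ᵛ d) →
               ∀ i → ψ (partials x v i) ≈ᵛ (ψ x +ᵛ (toℕ i · d))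
  ψ-partials x v v≈d zero j = sym (ℤ.+-identityʳ _)
  ψ-partials {n = suc _} x v {d} v≈d (suc i) j = begin
    ψ (partials (x ++ v zero) (v ∘ suc) i) j         ≡⟨ ψ-partials (x ++ v zero) (v ∘ suc) {d} (v≈d ∘ suc) i j ⟩
    ψ (x ++ v zero) j ℤ.+ (toℕ i · d) j              ≡⟨ cong (ℤ._+ (toℕ i · d) j) (ψ-++ x (v zero) j) ⟩
    ψ x j ℤ.+ ψ (v zero) j ℤ.+ (toℕ i · d) j         ≡⟨ cong (λ e → ψ x j ℤ.+ e ℤ.+ (toℕ i · d) j) (v≈d zero j) ⟩
    ψ x j ℤ.+ d j ℤ.+ (toℕ i · d) j                  ≡⟨ ℤ.+-assoc (ψ x j) (d j) _ ⟩
    ψ x j ℤ.+ (d j ℤ.+ (toℕ i · d) j)                ∎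
    where open ≡-Reasoning

  ≈⇒∼ : ∀ {x y} → x ≈ᵛ y → x ∼ y
  ≈⇒∼ {x} {y} x≈y = resp {x = 0ᵛ} {y = x -ᵛ y} (λ k → sym (ℤ.i≡j⇒i-j≡0 (x≈y k))) ε∈

  letter-image∼0 : ∀ σ → ψ (h [ σ ]) ∼ 0ᵛ
  letter-image∼0 σ = resp {x = ψ (h [ σ ])} {y = ψ (h [ σ ]) -ᵛ 0ᵛ}
    (λ k → sym (ℤ.+-identityʳ (ψ (h [ σ ]) k))) (gen (h [ σ ] , (σ , refl) , λ _ → refl))

  image∼0 : ∀ u → ψ (h u) ∼ 0ᵛ
  image∼0 []      = ≈⇒∼ {ψ (h [])} {0ᵛ} (λ k → cong (λ w → ψ w k) ε-homo)
  image∼0 (σ ∷ u) = begin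
    ψ (h (σ ∷ u))              ≈⟨ ≈⇒∼ {ψ (h (σ ∷ u))} {ψ (h [ σ ]) +ᵛ ψ (h u)}
      (λ k → trans (cong (λ w → ψ w k) (homo [ σ ] u)) (ψ-++ (h [ σ ]) (h u) k)) ⟩
    ψ (h [ σ ]) +ᵛ ψ (h u)     ≈⟨ ∼-+-cong {ψ (h [ σ ])} {0ᵛ} {ψ (h u)} {0ᵛ} (letter-image∼0 σ) (image∼0 u) ⟩
    0ᵛ +ᵛ 0ᵛ                   ≈⟨ ≈⇒∼ {0ᵛ +ᵛ 0ᵛ} {0ᵛ} (λ _ → refl) ⟩
    0ᵛ                         ∎
    where open ∼-Reasoning

  ψ-cut : ∀ {u q} (c : Cut u q) → ψ q ≈ᵛ (ψ (h (base c)) +ᵛ ψ (rest c))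
  ψ-cut c k = trans (cong (λ w → ψ w k) (split c)) (ψ-++ (h (base c)) (rest c) k)

  -- The image of the base contributes a sum of generators of the subgroup.
  ψ∼rest : ∀ {u q} (c : Cut u q) → ψ q ∼ ψ (rest c)
  ψ∼rest {q = q} c = begin
    ψ q                              ≈⟨ ≈⇒∼ {ψ q} {ψ (h (base c)) +ᵛ ψ (rest c)} (ψ-cut c) ⟩
    ψ (h (base c)) +ᵛ ψ (rest c)     ≈⟨ ∼-+-cong {ψ (h (base c))} {0ᵛ} {ψ (rest c)} {ψ (rest c)}
                                          (image∼0 (base c)) (∼-refl {ψ (rest c)}) ⟩
    0ᵛ +ᵛ ψ (rest c)                 ≈⟨ ≈⇒∼ {0ᵛ +ᵛ ψ (rest c)} {ψ (rest c)} (λ k → ℤ.+-identityˡ (ψ (rest c) k)) ⟩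
    ψ (rest c)                       ∎
    where open ∼-Reasoning

  -- The letter given as argument witnesses that the empty word lies in Pref(h), as an empty rest
  -- requires.
  rest∈𝒫 : ∀ {u q} → Fin m → (c : Cut u q) → ψ (rest c) ∈ 𝒫 h
  rest∈𝒫 σ (mkCut _ _ _ _ (inj₁ refl)) = [] , (σ , []) , λ _ → refl
  rest∈𝒫 _ (mkCut _ t _ _ (inj₂ i))    = t , (letter i , rest∈ i) , λ _ → refl

  multiple∼0 : ∀ {d} → d ∼ 0ᵛ → ∀ i → (i · d) ∼ 0ᵛ
  multiple∼0 {d} d∼0 zero    = ∼-refl {0ᵛ}
  multiple∼0 {d} d∼0 (suc i) = begin
    d +ᵛ (i · d)     ≈⟨ ∼-+-cong {d} {0ᵛ} {i · d} {0ᵛ} d∼0 (multiple∼0 {d} d∼0 i) ⟩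
    0ᵛ +ᵛ 0ᵛ         ≈⟨ ≈⇒∼ {0ᵛ +ᵛ 0ᵛ} {0ᵛ} (λ _ → refl) ⟩
    0ᵛ               ∎
    where open ∼-Reasoning

  -- Powers whose cut points have congruent rests

  module _ (o1 : O1 h) (o3 : O3 h) {n : ℕ} {u x : Word m} {v : Fin n → Word m}
    (free : AbelianPowerFree n (finite u)) (v≈v : ∀ i j → ψ (v i) ≈ᵛ ψ (v j))
    (cuts : ∀ i → Cut u (partials x v i)) where

    open O3 o3

    private
      P B R : Fin (suc n) → Vector m
      P i = ψ (partials x v i)
      B i = ψ (h (base (cuts i)))
      R i = ψ (rest (cuts i))

      P≈B+R : ∀ i → P i ≈ᵛ (B i +ᵛ R i)
      P≈B+R i = ψ-cut (cuts i)

    bases-increase : ∀ i → base (cuts (inject₁ i)) ∈ Pref (base (cuts (suc i)))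
    bases-increase i = base-mono o1 (cuts (inject₁ i)) (cuts (suc i))
      (subst (λ w → partials x v (inject₁ i) ∈ Pref w) (sym (partials-suc x v i))
        (Prefix-++ (partials x v (inject₁ i)) (v i)))

    -- All cut points exceed the images of their bases by the same vector, so the bases themselves
    -- cut `u`, with that vector negated as shift.
    equal-rests⇒[] : (∀ i → R i ≈ᵛ R zero) → ∀ i → v i ≡ []
    equal-rests⇒[] R≈R₀ = pull-back o1 free x v v≈v (λ i → base (cuts i)) (-ᵛ R zero)
      (λ i → base∈ (cuts i)) bases-increase shift
      where
      cancel : ∀ b r → b ≡ (b ℤ.+ r) ℤ.+ ℤ.- r
      cancel = solve-∀

      shift : ∀ i → B i ≈ᵛ (P i +ᵛ (-ᵛ R zero))
      shift i k = trans (cancel (B i k) (R zero k))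
        (cong (ℤ._+ ℤ.- R zero k) (trans (cong (λ e → B i k ℤ.+ e) (sym (R≈R₀ i k))) (sym (P≈B+R i k))))

    -- (O3) forces the next letter to be p after V and q after W, and then
    -- V − W = ψ(h p) − ψ(h q) makes ψ(h p) − V the common shift.
    two-rests⇒[] : (∀ i j → R i ∼ R j) → ∀ i₁ → ¬ (R i₁ ≈ᵛ R zero) → ∀ i → v i ≡ []
    two-rests⇒[] R∼R i₁ W≉V = pull-back o1 free x v v≈v next (ψ (h [ p ]) -ᵛ V)
      (λ i → within (inner i)) next-increase shift
      where
      V W : Vector m
      V = R zero
      W = R i₁

      Inside⇒≁0 : ∀ i → Inside u (base (cuts i)) (rest (cuts i)) → ¬ (R i ∼ 0ᵛ)
      Inside⇒≁0 i s = properPrefixes (letter s) (rest (cuts i)) (rest∈ s) (rest≢[] s) (rest≢h s)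

      -- An empty rest puts all rests in the zero class, which by (O3) contains the Parikh vector of
      -- no non-empty proper prefix of an image.
      all-[] : ∀ i → rest (cuts i) ≡ [] → ∀ j → rest (cuts j) ≡ []
      all-[] i ri≡[] j with position (cuts j)
      ... | inj₁ rj≡[] = rj≡[]
      ... | inj₂ s     = contradiction
        (∼-trans {R j} {R i} {0ᵛ} (R∼R j i) (≈⇒∼ {R i} {0ᵛ} (λ k → cong (λ w → ψ w k) ri≡[])))
        (Inside⇒≁0 j s)

      -- One empty rest would make them all empty, whereas the rests at `zero` and `i₁` have
      -- different Parikh vectors.
      inner : ∀ i → Inside u (base (cuts i)) (rest (cuts i))
      inner i with position (cuts i)
      ... | inj₂ s     = s
      ... | inj₁ ri≡[] = contradiction
        (λ k → cong (λ w → ψ w k) (trans (all-[] i ri≡[] i₁) (sym (all-[] i ri≡[] zero)))) W≉V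

      R∈𝒫 : ∀ i → R i ∈ 𝒫 h
      R∈𝒫 i = rest (cuts i) , (letter (inner i) , rest∈ (inner i)) , λ _ → refl

      V≁0 : ¬ (V ∼ 0ᵛ)
      V≁0 = Inside⇒≁0 zero (inner zero)

      V∉images : V ∉ ψ[ letterImages h ]
      V∉images (_ , (σ , refl) , V≈ψhσ) = V≁0
        (∼-trans {V} {ψ (h [ σ ])} {0ᵛ} (≈⇒∼ {V} {ψ (h [ σ ])} V≈ψhσ) (letter-image∼0 σ))

      V≉0 : ¬ (V ≈ᵛ 0ᵛ)
      V≉0 V≈0 = V≁0 (≈⇒∼ {V} {0ᵛ} V≈0)

      V≉W : ¬ (V ≈ᵛ W)
      V≉W V≈W = W≉V (λ k → sym (V≈W k))

      R∈class : ∀ i → R i ∈ [_]𝒫 h V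
      R∈class i = R∈𝒫 i , R∼R i zero

      -- `V` and `W` are already two distinct members of a class of at most two.
      class⊆ : ∀ y → y ∈ [_]𝒫 h V → y ≈ᵛ V ⊎ y ≈ᵛ W
      class⊆ y y∈ with smallClasses V (R∈𝒫 zero) V∉images V≉0 y V W y∈ (R∈class zero) (R∈class i₁)
      ... | inj₁ y≈V        = inj₁ y≈V
      ... | inj₂ (inj₁ y≈W) = inj₂ y≈W
      ... | inj₂ (inj₂ V≈W) = contradiction V≈W V≉W

      class-resp : ∀ i y → y ≈ᵛ R i → y ∈ [_]𝒫 h V
      class-resp i y y≈Ri =
        (rest (cuts i) , (letter (inner i) , rest∈ (inner i)) , y≈Ri) ,
        ∼-trans {y} {R i} {V} (≈⇒∼ {y} {R i} y≈Ri) (R∼R i zero)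

      class⊇ : ∀ y → y ≈ᵛ V ⊎ y ≈ᵛ W → y ∈ [_]𝒫 h V
      class⊇ y (inj₁ y≈V) = class-resp zero y y≈V
      class⊇ y (inj₂ y≈W) = class-resp i₁ y y≈W

      letters : UniqueLetters h V W
      letters = pairs V W (R∈𝒫 zero) V∉images V≉0 V≉W (λ y → mk⇔ (class⊆ y) (class⊇ y))

      p q : Fin m
      p = proj₁ letters
      q = proj₁ (proj₂ letters)

      V-W≈hp-hq : (V -ᵛ W) ≈ᵛ (ψ (h [ p ]) -ᵛ ψ (h [ q ]))
      V-W≈hp-hq = proj₁ (proj₂ (proj₂ letters))

      -- The rest is itself a prefix of the letter's image with Parikh vector `V`, so uniqueness in
      -- (O3) determines the letter.
      R≈V⇒letter≡p : ∀ i → R i ≈ᵛ V → letter (inner i) ≡ p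
      R≈V⇒letter≡p i Ri≈V = Equivalence.to (proj₁ (proj₂ (proj₂ (proj₂ letters))) (letter (inner i)))
        (rest (cuts i) , rest∈ (inner i) , λ k → sym (Ri≈V k))

      R≈W⇒letter≡q : ∀ i → R i ≈ᵛ W → letter (inner i) ≡ q
      R≈W⇒letter≡q i Ri≈W = Equivalence.to (proj₂ (proj₂ (proj₂ (proj₂ letters))) (letter (inner i)))
        (rest (cuts i) , rest∈ (inner i) , λ k → sym (Ri≈W k))

      next : Fin (suc n) → Word m
      next i = base (cuts i) ++ [ letter (inner i) ]

      -- Both words are prefixes of `u`, each one letter longer than its base, so the order of the
      -- bases carries over.
      next-increase : ∀ i → next (inject₁ i) ∈ Pref (next (suc i))
      next-increase i = Prefix-by-length (within (inner (inject₁ i))) (within (inner (suc i)))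
        (begin
          length (next (inject₁ i))                    ≡⟨ length-++ (base (cuts (inject₁ i))) ⟩
          length (base (cuts (inject₁ i))) ℕ.+ 1       ≤⟨ ℕ.+-monoˡ-≤ 1 (Prefix.length-mono (bases-increase i)) ⟩
          length (base (cuts (suc i))) ℕ.+ 1           ≡⟨ length-++ (base (cuts (suc i))) ⟨
          length (next (suc i))                        ∎)
        where open ℕ.≤-Reasoning

      ring₁ : ∀ b a c → b ℤ.+ a ≡ (b ℤ.+ c) ℤ.+ (a ℤ.+ ℤ.- c)
      ring₁ = solve-∀

      -- For e = ψ(h(q)) the inner sum v - w + e equals ψ(h(p)), so the shift found at `W` is the
      -- one found at `V`.
      ring₂ : ∀ b e v w → b ℤ.+ e ≡ (b ℤ.+ w) ℤ.+ (((v ℤ.+ ℤ.- w) ℤ.+ e) ℤ.+ ℤ.- v)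
      ring₂ = solve-∀

      ring₃ : ∀ a e → (a ℤ.+ ℤ.- e) ℤ.+ e ≡ a
      ring₃ = solve-∀

      V-W+hq≡hp : ∀ k → (V k ℤ.+ ℤ.- W k) ℤ.+ ψ (h [ q ]) k ≡ ψ (h [ p ]) k
      V-W+hq≡hp k = trans (cong (λ e → e ℤ.+ ψ (h [ q ]) k) (V-W≈hp-hq k))
        (ring₃ (ψ (h [ p ]) k) (ψ (h [ q ]) k))

      ψ-next : ∀ i k → ψ (h (next i)) k ≡ B i k ℤ.+ ψ (h [ letter (inner i) ]) k
      ψ-next i k = trans (cong (λ w → ψ w k) (homo (base (cuts i)) _)) (ψ-++ (h (base (cuts i))) _ k)

      P≡B+ : ∀ i {y} → R i ≈ᵛ y → ∀ k → P i k ≡ B i k ℤ.+ y k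
      P≡B+ i Ri≈y k = trans (P≈B+R i k) (cong (λ e → B i k ℤ.+ e) (Ri≈y k))

      shift : ∀ i → ψ (h (next i)) ≈ᵛ (P i +ᵛ (ψ (h [ p ]) -ᵛ V))
      shift i k with class⊆ (R i) (R∈class i)
      ... | inj₁ Ri≈V = begin
        ψ (h (next i)) k                                  ≡⟨ ψ-next i k ⟩
        B i k ℤ.+ ψ (h [ letter (inner i) ]) k            ≡⟨ cong (λ σ → B i k ℤ.+ ψ (h [ σ ]) k) (R≈V⇒letter≡p i Ri≈V) ⟩
        B i k ℤ.+ ψ (h [ p ]) k                           ≡⟨ ring₁ (B i k) (ψ (h [ p ]) k) (V k) ⟩
        (B i k ℤ.+ V k) ℤ.+ (ψ (h [ p ]) k ℤ.+ ℤ.- V k)   ≡⟨ cong (λ e → e ℤ.+ (ψ (h [ p ]) k ℤ.+ ℤ.- V k)) (P≡B+ i {V} Ri≈V k) ⟨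
        P i k ℤ.+ (ψ (h [ p ]) k ℤ.+ ℤ.- V k)             ∎
        where open ≡-Reasoning
      ... | inj₂ Ri≈W = begin
        ψ (h (next i)) k                                  ≡⟨ ψ-next i k ⟩
        B i k ℤ.+ ψ (h [ letter (inner i) ]) k            ≡⟨ cong (λ σ → B i k ℤ.+ ψ (h [ σ ]) k) (R≈W⇒letter≡q i Ri≈W) ⟩
        B i k ℤ.+ ψ (h [ q ]) k                           ≡⟨ ring₂ (B i k) (ψ (h [ q ]) k) (V k) (W k) ⟩
        (B i k ℤ.+ W k) ℤ.+ (((V k ℤ.+ ℤ.- W k) ℤ.+ ψ (h [ q ]) k) ℤ.+ ℤ.- V k)
          ≡⟨ cong (λ e → (B i k ℤ.+ W k) ℤ.+ (e ℤ.+ ℤ.- V k)) (V-W+hq≡hp k) ⟩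
        (B i k ℤ.+ W k) ℤ.+ (ψ (h [ p ]) k ℤ.+ ℤ.- V k)   ≡⟨ cong (λ e → e ℤ.+ (ψ (h [ p ]) k ℤ.+ ℤ.- V k)) (P≡B+ i {W} Ri≈W k) ⟨
        P i k ℤ.+ (ψ (h [ p ]) k ℤ.+ ℤ.- V k)             ∎
        where open ≡-Reasoning

    -- Equality of integer vectors is decidable: either all rests share one value, or some `i₁`
    -- supplies a second one.
    equivalent-rests⇒[] : (∀ i j → R i ∼ R j) → ∀ i → v i ≡ []
    equivalent-rests⇒[] R∼R with Fin.all? (λ i → R i ≟ᵛ R zero)
    ... | yes R≈R₀ = equal-rests⇒[] R≈R₀
    ... | no  R≉R₀ with i₁ , W≉V ← Fin.¬∀⟶∃¬ _ (λ i → R i ≈ᵛ R zero) (λ i → R i ≟ᵛ R zero) R≉R₀ =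
      two-rests⇒[] R∼R i₁ W≉V

  -- Images of finite words, then of arbitrary words

  finite-image-free : .{{_ : ℕ.NonZero n}} → Fin m → O1 h → O2 h n → O3 h →
                      ∀ u → AbelianPowerFree n (finite u) → AbelianPowerFree n (finite (h u))
  finite-image-free {n@(suc _)} σ₀ o1 o2 o3 u free x v xv∈ v≈v i =
    -- Emptiness of a word is decidable, so it may be proved by contradiction. This makes `d ∼ 0ᵛ`
    -- available without deciding membership in the subgroup.
    decidable-stable (≡-dec Fin._≟_ (v i) []) λ vi≢[] →
      d≁0-impossible λ d∼0 → vi≢[] (equivalent-rests⇒[] o1 o3 free v≈v cuts (rests∼ d∼0) i)
    where
    cuts : ∀ j → Cut u (partials x v j)
    cuts j = cut u (Prefix-trans (partials-prefix x v j) xv∈)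

    R : Fin (suc n) → Vector m
    R j = ψ (rest (cuts j))

    d : Vector m
    d = ψ (v zero)

    progression : ∀ j → (ψ x +ᵛ (toℕ j · d)) ∼ R j
    progression j = begin
      ψ x +ᵛ (toℕ j · d)       ≈⟨ ≈⇒∼ {ψ (partials x v j)} {ψ x +ᵛ (toℕ j · d)}
                                    (ψ-partials x v {d} (λ l → v≈v l zero) j) ⟨
      ψ (partials x v j)       ≈⟨ ψ∼rest (cuts j) ⟩
      R j                      ∎
      where open ∼-Reasoning

    d≁0-impossible : ¬ ¬ (d ∼ 0ᵛ)
    -- The classes of the n + 1 rests would form a non-trivial progression of length n + 1, against
    -- (O2).
    d≁0-impossible d≁0 = ℕ.<-irrefl refl (o2 (suc n) (ψ x , d , d≁0 , λ l l≤n →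
      R (fromℕ< l≤n) , rest∈𝒫 σ₀ (cuts (fromℕ< l≤n)) ,
      subst (λ e → (ψ x +ᵛ (e · d)) ∼ R (fromℕ< l≤n)) (Fin.toℕ-fromℕ< l≤n) (progression (fromℕ< l≤n))))

    R∼ψx : d ∼ 0ᵛ → ∀ j → R j ∼ ψ x
    R∼ψx d∼0 j = begin
      R j                      ≈⟨ progression j ⟨
      ψ x +ᵛ (toℕ j · d)       ≈⟨ ∼-+-cong {ψ x} {ψ x} {toℕ j · d} {0ᵛ} (∼-refl {ψ x}) (multiple∼0 {d} d∼0 (toℕ j)) ⟩
      ψ x +ᵛ 0ᵛ                ≈⟨ ≈⇒∼ {ψ x +ᵛ 0ᵛ} {ψ x} (λ k → ℤ.+-identityʳ (ψ x k)) ⟩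
      ψ x                      ∎
      where open ∼-Reasoning

    rests∼ : d ∼ 0ᵛ → ∀ j l → R j ∼ R l
    rests∼ d∼0 j l = begin
      R j    ≈⟨ R∼ψx d∼0 j ⟩
      ψ x    ≈⟨ R∼ψx d∼0 l ⟨
      R l    ∎
      where open ∼-Reasoning

theorem2p9 : ∀ (n m : ℕ) → 4 ≤ n → 2 ≤ m →
    (h : Word m → Word m) → IsMorphism h →
    O1 h → O2 h n → O3 h →
    AbelianPowerFreeMorphism n h
theorem2p9 n@(suc _) m@(suc _) _ _ h isMorphism o1 o2 o3 (finite u) _ refl free =
  finite-image-free h isMorphism zero o1 o2 o3 u free
-- By `IsImage` the prefix of `z` already lies in the image of a finite prefix of `s`, which
-- inherits power freeness from `s`.
theorem2p9 n@(suc _) m@(suc _) _ _ h isMorphism o1 o2 o3 (infinite s) z image free x v xv≼z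
  with l , xv∈ ← Equivalence.to (image (x ++ concat (tabulate v))) xv≼z =
  finite-image-free h isMorphism zero o1 o2 o3 (applyUpTo s l)
    (λ x′ v′ x′v′∈ → free x′ v′ (Prefix-applyUpTo s l x′v′∈)) x v xv∈
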